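{- For every positive integer $n$, $$A166079(n)=n-b_{n,1}.$$
   Context: Places $1,\dots,n$ stand in a row; neighbouring places have distance $1$. At any time at which at least one place is occupied, the distance of an empty place $x$ is $\min|x-y|$ over all occupied places $y$. Persons arrive one after another and each occupies one empty place. Politeness rule: every person except the first occupies one of the empty places whose distance is maximal among all empty places at that time. $A166079(n)$ is the number of persons who can take one of $n$ initially empty places in a row, assuming that the first person takes a place at an end of the row, that every later person obeys the politeness rule, and that nobody takes a place neighbouring an occupied one (the process stops when every empty place has distance $1$ or no place is empty). $b_{n,1}$ is the number of persons (the first person is not counted) who, at the moment of choosing, occupy a place of distance exactly $1$, when $n$ persons fill all $n$ places according to the politeness rule (without the prohibition on neighbouring places) and the first person takes the leftmost place. These numbers do not depend on the choices made. -}

module Defs where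

open import Data.Fin using (Fin; toℕ)
open import Data.Fin.Subset using (Subset; _∈_; _∉_; _∪_; ⁅_⁆; ⊤)
open import Data.List using (List; []; _∷_; length; filter)
open import Data.Nat using (ℕ; suc; _≤_; ∣_-_∣; _≟_)
open import Data.Product using (_×_; ∃-syntax)
open import Data.Sum using (_⊎_)
open import Data.Unit using () renaming (⊤ to Unit)
open import Relation.Binary.PropositionalEquality using (_≡_; _≢_)

private
  variable
    n : ℕ

-- A row of n places is Fin n; a state of the process is the set O of
-- occupied places.

-- Distance O x d : the minimum of |x - y| over all y in O exists and equals d.
-- (Nothing satisfies it when O is empty, where the distance is undefined.)
record Distance (O : Subset n) (x : Fin n) (d : ℕ) : Set where
  field
    attained : ∃[ y ] (y ∈ O × ∣ toℕ x - toℕ y ∣ ≡ d)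
    minimal  : ∀ y → y ∈ O → d ≤ ∣ toℕ x - toℕ y ∣

record Polite (O : Subset n) (x : Fin n) (d : ℕ) : Set where
  field
    empty    : x ∉ O
    distance : Distance O x d
    maximal  : ∀ y e → y ∉ O → Distance O y e → e ≤ d

-- Arrivals Allowed O O′ ds : starting from O, persons arrive one after another,
-- each choosing politely a place that satisfies the extra restriction Allowed,
-- and O′ is occupied afterwards. The list ds records, in order of arrival, the
-- distance of each chosen place at the moment of choosing.
data Arrivals (Allowed : Subset n → Fin n → Set) :
              Subset n → Subset n → List ℕ → Set where
  done   : ∀ {O} → Arrivals Allowed O O []
  arrive : ∀ {O O′ x d ds} → Polite O x d → Allowed O x →
           Arrivals Allowed (O ∪ ⁅ x ⁆) O′ ds → Arrivals Allowed O O′ (d ∷ ds)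

NotNeighbouring : Subset n → Fin n → Set
NotNeighbouring O x = ∀ y → y ∈ O → ∣ toℕ x - toℕ y ∣ ≢ 1

Unrestricted : Subset n → Fin n → Set
Unrestricted O x = Unit

record SpacedSeating (n : ℕ) : Set where
  field
    first     : Fin n
    first-end : toℕ first ≡ 0 ⊎ suc (toℕ first) ≡ n
    final     : Subset n
    distances : List ℕ
    arrivals  : Arrivals NotNeighbouring ⁅ first ⁆ final distances
    -- Holds vacuously when no place is empty.
    stopped   : ∀ x → x ∉ final → Distance final x 1

  persons : ℕ
  persons = suc (length distances)

record FullSeating (n : ℕ) : Set where
  field
    first          : Fin n
    first-leftmost : toℕ first ≡ 0
    distances      : List ℕ
    arrivals       : Arrivals Unrestricted ⁅ first ⁆ ⊤ distances

  personsAtDistance : ℕ → ℕ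
  personsAtDistance d = length (filter (_≟ d) distances)

-- "The value of f, which does not depend on the choices made, is v."
CommonValue : {S : Set} → (S → ℕ) → ℕ → Set
CommonValue {S} f v = (∃[ s ] f s ≡ v) × (∀ (s : S) → f s ≡ v)

IsA166079 : ℕ → ℕ → Set
IsA166079 n a = CommonValue (SpacedSeating.persons {n}) a

-- IsB n d b : the number b_{n,d} is b.
IsB : ℕ → ℕ → ℕ → Set
IsB n d b = CommonValue (λ (s : FullSeating n) → FullSeating.personsAtDistance s d) b

module Submission where

-- Give a gap of width w between neighbouring occupied places the weight g w,
-- where g w = 0 for w ≤ 3 and g w = 1 + g ⌊w/2⌋ + g ⌈w/2⌉ otherwise, and let Φ
-- be the total weight of a state. A polite person at distance at least 2 halves
-- the gap (or, in an end gap, takes the end of the row), which lowers Φ by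
-- exactly 1; once every empty place has distance 1, Φ is 0 and stays 0. So in
-- both processes exactly Φ (start) persons sit at distance at least 2, whatever
-- the choices, and Φ (start) is the same for both ends of the row. Then
-- A166079(n) = 1 + Φ (start) and b(n,1) = n - 1 - Φ (start).

open import Data.Bool using (true; false)
open import Data.Fin using (Fin; zero; suc; toℕ; fromℕ<; inject₁)
open import Data.Fin.Properties using (toℕ<n; toℕ-fromℕ<; toℕ-inject₁; toℕ-injective; any?)
open import Data.Fin.Subset using (Subset; _∈_; _∉_; _∪_; ⁅_⁆; ∣_∣) renaming (⊤ to full; ⊥ to none)
open import Data.Fin.Subset.Properties
  using (_∈?_; ∪-identityʳ; ∣p∣≤n; ∈⊤; ⊆⊤; ⊆-antisym; p⊆p∪q; x∈⁅x⁆; ∣⁅x⁆∣≡1; ∣⊤∣≡n)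
open import Data.List using (List; []; _∷_; length; filter; allFin)
open import Data.List.Membership.Propositional.Properties using (∈-filter⁺; ∈-allFin)
open import Data.List.Properties using (filter-all; filter-accept; filter-reject)
open import Data.List.Relation.Unary.All as All using (All; []; _∷_)
open import Data.List.Relation.Unary.All.Properties using (all-filter)
open import Data.Nat
open import Data.Nat.Properties
open import Data.Product using (_×_; _,_; proj₁; proj₂; ∃-syntax)
open import Data.Sum using (_⊎_; inj₁; inj₂)
open import Data.Unit using (tt)
open import Data.Vec using ([]; _∷_; here; there)
open import Function using (_∘_)
open import Relation.Binary.PropositionalEquality
open import Relation.Nullary using (¬_; yes; no; ¬?; contradiction)
open import Relation.Nullary.Decidable using (decidable-stable)

open import Defs

open import Data.List.Extrema ≤-totalOrder
  using (argmin; argmax; argmin-all; argmax-all; f[argmin]≤f[xs]; f[xs]≤f[argmax])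

private
  variable
    n : ℕ

-- The weight of a gap

-- The first argument is fuel; any value that is at least the width will do.
halvings : ℕ → ℕ → ℕ
halvings zero    w = 0
halvings (suc f) w@(suc (suc (suc (suc _)))) =
  suc (halvings f ⌊ w /2⌋ + halvings f ⌈ w /2⌉)
halvings (suc f) _ = 0

halvings-fuel : ∀ f f′ w → w ≤ f → w ≤ f′ → halvings f w ≡ halvings f′ w
halvings-fuel zero    zero     w _ _ = refl
halvings-fuel zero    (suc f′) 0 _ _ = refl
halvings-fuel (suc f) zero     0 _ _ = refl
halvings-fuel (suc f) (suc f′) 0 _ _ = refl
halvings-fuel (suc f) (suc f′) 1 _ _ = refl
halvings-fuel (suc f) (suc f′) 2 _ _ = refl
halvings-fuel (suc f) (suc f′) 3 _ _ = refl
halvings-fuel (suc f) (suc f′) (suc (suc (suc (suc w)))) (s≤s p) (s≤s p′) =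
  cong suc (cong₂ _+_
    (halvings-fuel f f′ _ (≤-trans ⌊⌋≤ p) (≤-trans ⌊⌋≤ p′))
    (halvings-fuel f f′ _ (≤-trans ⌈⌉≤ p) (≤-trans ⌈⌉≤ p′)))
  where
  ⌊⌋≤ : ⌊ 4 + w /2⌋ ≤ 3 + w
  ⌊⌋≤ = ≤-pred (⌊n/2⌋<n (3 + w))
  ⌈⌉≤ : ⌈ 4 + w /2⌉ ≤ 3 + w
  ⌈⌉≤ = s≤s (s≤s (⌊n/2⌋≤n (suc w)))

g : ℕ → ℕ
g w = halvings w w

g-halve : ∀ w → 4 ≤ w → g w ≡ suc (g ⌊ w /2⌋ + g ⌈ w /2⌉)
g-halve w@(suc (suc (suc (suc u)))) _ = cong suc (cong₂ _+_
  (halvings-fuel (3 + u) _ _ (≤-pred (⌊n/2⌋<n (3 + u))) ≤-refl)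
  (halvings-fuel (3 + u) _ _ (s≤s (s≤s (⌊n/2⌋≤n (suc u)))) ≤-refl))
g-halve 1 (s≤s ())
g-halve 2 (s≤s (s≤s ()))
g-halve 3 (s≤s (s≤s (s≤s ())))

g-even : ∀ d → 2 ≤ d → g (d + d) ≡ suc (g d + g d)
g-even d 2≤d = trans (g-halve (d + d) (+-mono-≤ 2≤d 2≤d))
  (sym (cong₂ (λ u v → suc (g u + g v)) (n≡⌊n+n/2⌋ d) (n≡⌈n+n/2⌉ d)))

g-odd : ∀ d → 2 ≤ d → g (suc (d + d)) ≡ suc (g d + g (suc d))
g-odd d 2≤d = trans (g-halve (suc (d + d)) (m≤n⇒m≤1+n (+-mono-≤ 2≤d 2≤d)))
  (sym (cong₂ (λ u v → suc (g u + g v)) (n≡⌈n+n/2⌉ d) (cong suc (n≡⌊n+n/2⌋ d))))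

d≤m≤1+d : ∀ {m d} → d ≤ m → m ≤ suc d → m ≡ d ⊎ m ≡ suc d
d≤m≤1+d d≤m m≤1+d with m≤n⇒m<n∨m≡n m≤1+d
... | inj₁ m<1+d = inj₁ (≤-antisym (≤-pred m<1+d) d≤m)
... | inj₂ m≡1+d = inj₂ m≡1+d

-- Widths that are both d or d + 1 are the floor and the ceiling of half their sum, in one order or
-- the other, and 2 ≤ d makes the sum at least 4.
g-balanced : ∀ {a m d} → 2 ≤ d → d ≤ a → a ≤ suc d → d ≤ m → m ≤ suc d →
             g (a + m) ≡ suc (g a + g m)
g-balanced {d = d} 2≤d d≤a a≤1+d d≤m m≤1+d
  with d≤m≤1+d d≤a a≤1+d | d≤m≤1+d d≤m m≤1+d
... | inj₁ refl | inj₁ refl = g-even d 2≤d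
... | inj₁ refl | inj₂ refl = trans (cong g (+-suc d d)) (g-odd d 2≤d)
... | inj₂ refl | inj₁ refl = trans (g-odd d 2≤d) (cong suc (+-comm (g d) (g (suc d))))
... | inj₂ refl | inj₂ refl = g-even (suc d) (m≤n⇒m≤1+n 2≤d)

-- A run of ℓ empty places at an end of the row.
h : ℕ → ℕ
h 0 = 0
h 1 = 0
h ℓ = suc (g ℓ)

h-suc : ∀ {ℓ} → 2 ≤ ℓ → h ℓ ≡ suc (g ℓ)
h-suc {suc (suc ℓ)} _ = refl
h-suc {1} (s≤s ())

-- Total weight of a state

data Side : Set where
  wall seat : Side

-- The walls stand at the positions -1 and n, so that a gap of width w next to
-- one wall has w - 1 empty places.
weight : Side → Side → ℕ → ℕ
weight seat seat w = g w
weight seat wall w = h (pred w)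
weight wall seat w = h (pred w)
weight wall wall w = 0

-- The vector is the part of the row that starts k places after s, the last
-- wall or seat.
Φ-from : Side → ℕ → Subset n → ℕ
Φ-from s k []          = weight s wall k
Φ-from s k (true  ∷ O) = weight s seat k + Φ-from seat 1 O
Φ-from s k (false ∷ O) = Φ-from s (suc k) O

Φ : Subset n → ℕ
Φ = Φ-from wall 1

Φ-from-none : ∀ n s k → Φ-from s k (none {n}) ≡ weight s wall (n + k)
Φ-from-none zero    s k = refl
Φ-from-none (suc n) s k = trans (Φ-from-none n s (suc k)) (cong (weight s wall) (+-suc n k))

Φ-from-⁅x⁆ : ∀ s k (x : Fin n) →
             Φ-from s k ⁅ x ⁆ ≡ weight s seat (toℕ x + k) + weight seat wall (n ∸ toℕ x)
Φ-from-⁅x⁆ {suc n} s k zero = cong (weight s seat k +_)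
  (trans (Φ-from-none n seat 1) (cong (weight seat wall) (+-comm n 1)))
Φ-from-⁅x⁆ {suc n} s k (suc x) = trans (Φ-from-⁅x⁆ s (suc k) x)
  (cong (λ w → weight s seat w + weight seat wall (n ∸ toℕ x)) (+-suc (toℕ x) k))

-- The near wall leaves a gap of width 1, which weighs `h 0` = 0; on the other side there are n
-- empty places.
Φ-end : ∀ {n} (x : Fin (suc n)) → toℕ x ≡ 0 ⊎ suc (toℕ x) ≡ suc n → Φ ⁅ x ⁆ ≡ h n
Φ-end {n} x end = trans (Φ-from-⁅x⁆ wall 1 x) (lemma end)
  where
  lemma : toℕ x ≡ 0 ⊎ suc (toℕ x) ≡ suc n →
          h (pred (toℕ x + 1)) + h (pred (suc n ∸ toℕ x)) ≡ h n
  lemma (inj₁ eq) rewrite eq = refl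
  lemma (inj₂ eq) rewrite suc-injective eq | +-comm n 1 | m+n∸n≡m 1 n = +-identityʳ (h n)

-- The gap around an empty place

-- LeftEnd s k O x s′ a: the nearest seat to the left of x is at distance a,
-- or there is none and the gap extends to s, which is k places before O.
data LeftEnd (s : Side) (k : ℕ) (O : Subset n) (x : Fin n) : Side → ℕ → Set where
  outer : LeftEnd s k O x s (toℕ x + k)
  inner : ∀ {y a} → y ∈ O → toℕ y + a ≡ toℕ x → LeftEnd s k O x seat a

-- Measured from a number `p` and not from a place, because `FirstGap` uses p = 0 for a row that may
-- have no places.
data RightEnd {n} (O : Subset n) (p : ℕ) : Side → ℕ → Set where
  outer : ∀ {m} → n ≡ p + m → RightEnd O p wall m
  inner : ∀ {z m} → z ∈ O → toℕ z ≡ p + m → RightEnd O p seat m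

right-shift : ∀ {b} {O : Subset n} {p t m} → RightEnd O p t m → RightEnd (b ∷ O) (suc p) t m
right-shift (outer eq)    = outer (cong suc eq)
right-shift (inner z∈ eq) = inner (there z∈) (cong suc eq)

right-widen : ∀ {b} {O : Subset n} {t m} → RightEnd O 0 t m → RightEnd (b ∷ O) 0 t (suc m)
right-widen (outer eq)    = outer (cong suc eq)
right-widen (inner z∈ eq) = inner (there z∈) (cong suc eq)

-- Adding a to y instead of subtracting it from x keeps place 0 in the interval when the gap reaches
-- the left wall, at x - a = -1.
Vacant : Subset n → Fin n → ℕ → ℕ → Set
Vacant O x a m = ∀ y → toℕ x < toℕ y + a → toℕ y < toℕ x + m → y ∉ O

-- `split` holds for every left end, because `gapAround` needs it twice: for the gap before the
-- arrival and for its right part afterwards.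
record FirstGap (O : Subset n) : Set where
  field
    {t}    : Side
    {m}    : ℕ
    rest   : ℕ
    end    : RightEnd O 0 t m
    vacant : ∀ y → toℕ y < m → y ∉ O
    split  : ∀ s k → Φ-from s k O ≡ weight s t (m + k) + rest

firstGap : (O : Subset n) → FirstGap O
firstGap [] = record
  { rest = 0 ; end = outer refl ; vacant = λ () ; split = λ s k → sym (+-identityʳ _) }
firstGap (true ∷ O) = record
  { rest = Φ-from seat 1 O ; end = inner here refl ; vacant = λ _ () ; split = λ s k → refl }
firstGap (false ∷ O) with firstGap O
... | record { t = t ; m = m ; rest = R ; end = end ; vacant = vac ; split = split } = record
  { rest   = R
  ; end    = right-widen end
  ; vacant = λ { zero _ () ; (suc y) (s≤s y<m) (there y∈O) → vac y y<m y∈O }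
  ; split  = λ s k → trans (split s (suc k)) (cong (λ w → weight s t w + R) (+-suc m k))
  }

-- The common `rest` reduces the change of `Φ` to the weights of the single gap that x splits.
record Gap (s : Side) (k : ℕ) (O : Subset n) (x : Fin n) : Set where
  field
    {s′ t} : Side
    {a m}  : ℕ
    rest   : ℕ
    left   : LeftEnd s k O x s′ a
    right  : RightEnd O (toℕ x) t m
    vacant : Vacant O x a m
    before : Φ-from s k O ≡ weight s′ t (a + m) + rest
    after  : Φ-from s k (O ∪ ⁅ x ⁆) ≡ (weight s′ seat a + weight seat t m) + rest

gapAround : ∀ s k (O : Subset n) (x : Fin n) → x ∉ O → Gap s k O x
gapAround s k (true ∷ O) zero x∉O = contradiction here x∉O
gapAround s k (false ∷ O) zero x∉O with firstGap O
... | record { t = t ; m = m ; rest = R ; end = end ; vacant = vac ; split = split } = record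
  { rest   = R
  ; left   = outer
  ; right  = right-widen end
  ; vacant = λ { zero _ _ () ; (suc y) _ (s≤s y<m) (there y∈O) → vac y y<m y∈O }
  ; before = trans (split s (suc k))
      (cong (λ w → weight s t w + R) (trans (+-suc m k) (+-comm (suc m) k)))
  ; after  = trans (cong (λ v → weight s seat k + Φ-from seat 1 v) (∪-identityʳ O))
      (trans (cong (weight s seat k +_)
               (trans (split seat 1) (cong (λ w → weight seat t w + R) (+-comm m 1))))
        (sym (+-assoc (weight s seat k) _ R)))
  }
gapAround s k (true ∷ O) (suc x) x∉O with gapAround seat 1 O x (x∉O ∘ there)
... | record { s′ = s′ ; t = t ; a = a ; m = m ; rest = R
             ; left = left ; right = right ; vacant = vac ; before = bef ; after = aft } = record
  { rest   = weight s seat k + R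
  ; left   = proj₁ (shift left)
  ; right  = right-shift right
  -- Place 0 is a seat and must lie outside the gap, which is what the bound on a from `shift`
  -- gives.
  ; vacant = λ { zero x<a _ _ → <⇒≱ x<a (proj₂ (shift left))
               ; (suc y) (s≤s l) (s≤s r) (there y∈O) → vac y l r y∈O }
  ; before = insert bef
  ; after  = insert aft
  }
  where
  shift : ∀ {s′ a} → LeftEnd seat 1 O x s′ a →
          LeftEnd s k (true ∷ O) (suc x) s′ a × a ≤ suc (toℕ x)
  shift outer = inner here (+-comm (toℕ x) 1) , ≤-reflexive (+-comm (toℕ x) 1)
  shift {a = a} (inner {y} y∈ eq) =
    inner (there y∈) (cong suc eq) , m≤n⇒m≤1+n (≤-trans (m≤n+m a (toℕ y)) (≤-reflexive eq))
  insert : ∀ {u w} → u ≡ w + R → weight s seat k + u ≡ w + (weight s seat k + R)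
  insert {w = w} refl = trans (sym (+-assoc (weight s seat k) w R))
    (trans (cong (_+ R) (+-comm (weight s seat k) w)) (+-assoc w _ R))
gapAround s k (false ∷ O) (suc x) x∉O with gapAround s (suc k) O x (x∉O ∘ there)
... | record { s′ = s′ ; t = t ; a = a ; m = m ; rest = R
             ; left = left ; right = right ; vacant = vac ; before = bef ; after = aft } = record
  { rest   = R
  ; left   = shift left
  ; right  = right-shift right
  ; vacant = λ { zero _ _ () ; (suc y) (s≤s l) (s≤s r) (there y∈O) → vac y l r y∈O }
  ; before = bef
  ; after  = aft
  }
  where
  shift : ∀ {s′ a} → LeftEnd s (suc k) O x s′ a → LeftEnd s k (false ∷ O) (suc x) s′ a
  shift outer         = subst (LeftEnd s k (false ∷ O) (suc x) s) (sym (+-suc (toℕ x) k)) outer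
  shift (inner y∈ eq) = inner (there y∈) (cong suc eq)

-- A polite step

Close : Subset n → ℕ → Set
Close O d = ∀ p → p ∉ O → ∃[ y ] (y ∈ O × ∣ toℕ p - toℕ y ∣ ≤ d)

close-⊆ : ∀ {O O′ : Subset n} {d} → (∀ {y} → y ∈ O → y ∈ O′) → Close O d → Close O′ d
close-⊆ O⊆O′ close p p∉O′ with close p (p∉O′ ∘ O⊆O′)
... | y , y∈O , le = y , O⊆O′ y∈O , le

distance-exists : ∀ {O : Subset n} {y} → y ∈ O → ∀ x → ∃[ d ] Distance O x d
distance-exists {n} {O} {y₀} y₀∈O x = _ , record
  { attained = nearest , argmin-all δ y₀∈O (all-filter (_∈? O) (allFin n)) , refl
  ; minimal  = λ y y∈O → All.lookup (f[argmin]≤f[xs] y₀ seats) (∈-filter⁺ (_∈? O) (∈-allFin y) y∈O)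
  }
  where
  δ : Fin n → ℕ
  δ y = ∣ toℕ x - toℕ y ∣
  seats : List (Fin n)
  seats = filter (_∈? O) (allFin n)
  nearest : Fin n
  nearest = argmin δ y₀ seats

distance-positive : ∀ {O : Subset n} {x d} → x ∉ O → Distance O x d → 1 ≤ d
distance-positive {O = O} {d = suc d} _ _ = s≤s z≤n
distance-positive {O = O} {d = zero} x∉O D with Distance.attained D
... | y , y∈O , eq = contradiction (subst (_∈ O) (sym (toℕ-injective (∣m-n∣≡0⇒m≡n eq))) y∈O) x∉O

-- `maximal` bounds only distances known to exist, so the distance of p is constructed first.
polite-close : ∀ {O : Subset n} {x d} → Polite O x d → Close O d
polite-close P p p∉O with Distance.attained (Polite.distance P)
... | y₀ , y₀∈O , _ with distance-exists y₀∈O p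
... | e , D with Distance.attained D
... | y , y∈O , refl = y , y∈O , Polite.maximal P p e p∉O D

module _ {O : Subset n} {x : Fin n} {a m : ℕ} (vacant : Vacant O x a m) where

  beyond-gap : ∀ {y} → y ∈ O → toℕ y + a ≤ toℕ x ⊎ toℕ x + m ≤ toℕ y
  beyond-gap {y} y∈O with toℕ y + a ≤? toℕ x | toℕ x + m ≤? toℕ y
  ... | yes l | _     = inj₁ l
  ... | no _  | yes r = inj₂ r
  ... | no ¬l | no ¬r = contradiction y∈O (vacant y (≰⇒> ¬l) (≰⇒> ¬r))

-- The place x - 1 is empty because 2 ≤ a, so some seat is within d of it. A seat to the left is at
-- least a - 1 away, which gives a ≤ d + 1; one to the right is at least m + 1 away, which gives m <
-- d.
left-close : ∀ {O : Subset n} {x a m d} → Vacant O x a m → Close O d → 1 ≤ toℕ x → 2 ≤ a →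
             (∃[ y ] (toℕ {n} y + a ≤ toℕ x × a ≤ suc d)) ⊎ m < d
left-close {O = O} {x = suc x} {a} {m} {d} vacant close _ 2≤a
  with close (inject₁ x) (vacant (inject₁ x)
    (subst (λ v → suc (toℕ x) < v + a) (sym (toℕ-inject₁ x))
      (subst (_≤ toℕ x + a) (+-comm (toℕ x) 2) (+-monoʳ-≤ (toℕ x) 2≤a)))
    (subst (_< suc (toℕ x) + m) (sym (toℕ-inject₁ x)) (s≤s (m≤m+n (toℕ x) m))))
... | y , y∈O , le rewrite toℕ-inject₁ x with beyond-gap vacant y∈O
... | inj₁ l = inj₁ (y , l , +-cancelˡ-≤ (toℕ y) _ _ (begin
    toℕ y + a                           ≤⟨ l ⟩
    suc (toℕ x)                         ≤⟨ s≤s (m≤n+∣m-n∣ (toℕ x) (toℕ y)) ⟩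
    suc (toℕ y + ∣ toℕ x - toℕ y ∣)     ≤⟨ s≤s (+-monoʳ-≤ (toℕ y) le) ⟩
    suc (toℕ y + d)                     ≡⟨ +-suc (toℕ y) d ⟨
    toℕ y + suc d                       ∎))
  where open ≤-Reasoning
... | inj₂ r = inj₂ (+-cancelˡ-≤ (toℕ x) _ _ (begin
    toℕ x + suc m                       ≡⟨ +-suc (toℕ x) m ⟩
    suc (toℕ x) + m                     ≤⟨ r ⟩
    toℕ y                               ≤⟨ m≤n+∣n-m∣ (toℕ y) (toℕ x) ⟩
    toℕ x + ∣ toℕ x - toℕ y ∣           ≤⟨ +-monoʳ-≤ (toℕ x) le ⟩
    toℕ x + d                           ∎))
  where open ≤-Reasoning

-- The mirror image, with x + 1 as the test place.
right-close : ∀ {O : Subset n} {x a m d} → Vacant O x a m → Close O d → suc (toℕ x) < n → 2 ≤ m →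
              a < d ⊎ (∃[ z ] (toℕ x + m ≤ toℕ {n} z × m ≤ suc d))
right-close {O = O} {x = x} {a} {m} {d} vacant close x+1<n 2≤m
  with close (fromℕ< x+1<n) (vacant (fromℕ< x+1<n)
    (subst (λ v → toℕ x < v + a) (sym (toℕ-fromℕ< x+1<n)) (s≤s (m≤m+n (toℕ x) a)))
    (subst (_< toℕ x + m) (sym (toℕ-fromℕ< x+1<n))
      (subst (_≤ toℕ x + m) (+-comm (toℕ x) 2) (+-monoʳ-≤ (toℕ x) 2≤m))))
... | y , y∈O , le rewrite toℕ-fromℕ< x+1<n with beyond-gap vacant y∈O
... | inj₁ l = inj₁ (+-cancelˡ-≤ (toℕ y) _ _ (begin
    toℕ y + suc a                       ≡⟨ +-suc (toℕ y) a ⟩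
    suc (toℕ y + a)                     ≤⟨ s≤s l ⟩
    suc (toℕ x)                         ≤⟨ m≤n+∣m-n∣ (suc (toℕ x)) (toℕ y) ⟩
    toℕ y + ∣ suc (toℕ x) - toℕ y ∣     ≤⟨ +-monoʳ-≤ (toℕ y) le ⟩
    toℕ y + d                           ∎))
  where open ≤-Reasoning
... | inj₂ r = inj₂ (y , r , +-cancelˡ-≤ (toℕ x) _ _ (begin
    toℕ x + m                               ≤⟨ r ⟩
    toℕ y                                   ≤⟨ m≤n+∣n-m∣ (toℕ y) (suc (toℕ x)) ⟩
    suc (toℕ x) + ∣ suc (toℕ x) - toℕ y ∣   ≤⟨ +-monoʳ-≤ (suc (toℕ x)) le ⟩
    suc (toℕ x) + d                         ≡⟨ +-suc (toℕ x) d ⟨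
    toℕ x + suc d                           ∎))
  where open ≤-Reasoning

-- A seat at either end of the gap is at least d away from x. Closeness at the places next to x
-- gives the upper bounds: between two seats both parts have width d or d + 1, and in a gap next to
-- a wall x has to be the end of the row.
weight-step : ∀ {n} {O : Subset n} {x d s t a m} → Polite O x d → 2 ≤ d → Vacant O x a m →
              LeftEnd wall 1 O x s a → RightEnd O (toℕ x) t m →
              weight s t (a + m) ≡ suc (weight s seat a + weight seat t m)
weight-step {n} {O} {x} {d} P 2≤d vacant = go vacant
  where
  open Polite P
  close : Close O d
  close = polite-close P

  far-left : ∀ {y a} → y ∈ O → toℕ y + a ≡ toℕ x → d ≤ a
  far-left {y} {a} y∈O eq = subst (d ≤_)
    (trans (cong (λ v → ∣ v - toℕ y ∣) (sym eq)) (∣m+n-m∣≡n (toℕ y) a))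
    (Distance.minimal distance y y∈O)
    where
    ∣m+n-m∣≡n : ∀ m n → ∣ m + n - m ∣ ≡ n
    ∣m+n-m∣≡n m n = trans (∣-∣-comm (m + n) m) (∣m-m+n∣≡n m n)

  far-right : ∀ {z m} → z ∈ O → toℕ z ≡ toℕ x + m → d ≤ m
  far-right {z} {m} z∈O eq = subst (d ≤_)
    (trans (cong (λ v → ∣ toℕ x - v ∣) eq) (∣m-m+n∣≡n (toℕ x) m))
    (Distance.minimal distance z z∈O)

  2+≤ : ∀ p {m} → 2 ≤ m → suc (suc p) ≤ p + m
  2+≤ p {m} 2≤m = subst (_≤ p + m) (+-comm p 2) (+-monoʳ-≤ p 2≤m)

  2≤ : ∀ p {m} → suc (suc p) ≤ p + m → 2 ≤ m
  2≤ p {m} le = +-cancelˡ-≤ p 2 m (subst (_≤ p + m) (+-comm 2 p) le)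

  ¬past-left : ∀ y → ¬ (toℕ {n} y + (toℕ x + 1) ≤ toℕ x)
  ¬past-left y le = m+1+n≰m (toℕ x) (m+n≤o⇒n≤o (toℕ y) le)

  ¬past-right : ∀ {m} z → n ≡ toℕ x + m → ¬ (toℕ x + m ≤ toℕ {n} z)
  ¬past-right z eq le = <⇒≱ (toℕ<n z) (subst (_≤ toℕ z) (sym eq) le)

  go : ∀ {s t a m} → Vacant O x a m → LeftEnd wall 1 O x s a → RightEnd O (toℕ x) t m →
       weight s t (a + m) ≡ suc (weight s seat a + weight seat t m)
  -- Two walls would mean a row without seats, but the distance of x is attained by some seat.
  go vacant outer (outer eq) with Distance.attained distance
  ... | y , y∈O , _ with beyond-gap vacant y∈O
  ... | inj₁ l = contradiction l (¬past-left y)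
  ... | inj₂ r = contradiction r (¬past-right y eq)
  go vacant outer (inner z∈O eq) with far-right z∈O eq | 1 ≤? toℕ x
  -- At the left end the part towards the wall weighs `h 0` = 0, and the claim becomes h m = 1 + g
  -- m.
  ... | d≤m | no 1≰x rewrite n<1⇒n≡0 (≰⇒> 1≰x) = h-suc (≤-trans 2≤d d≤m)
  -- Otherwise x - 1 would be empty and farther from every seat than x, as all seats lie to the
  -- right.
  ... | d≤m | yes 1≤x with left-close vacant close 1≤x (+-monoˡ-≤ 1 1≤x)
  ...   | inj₁ (y , l , _) = contradiction l (¬past-left y)
  ...   | inj₂ m<d         = contradiction d≤m (<⇒≱ m<d)
  go {a = a} {m} vacant (inner y∈O eq) (outer eqₙ) with suc (toℕ x) <? n
  ... | yes x+1<n with right-close vacant close x+1<n (2≤ (toℕ x) (subst (suc (toℕ x) <_) eqₙ x+1<n))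
  ...   | inj₁ a<d         = contradiction (far-left y∈O eq) (<⇒≱ a<d)
  ...   | inj₂ (z , r , _) = contradiction r (¬past-right z eqₙ)
  -- Here x is the last place, so m = 1 and the part towards the wall weighs `h 0` = 0.
  go {a = a} {m} vacant (inner y∈O eq) (outer eqₙ) | no x+1≮n
    with +-cancelˡ-≡ (toℕ x) m 1
           (trans (sym eqₙ) (trans (≤-antisym (≮⇒≥ x+1≮n) (toℕ<n x)) (+-comm 1 (toℕ x))))
  ... | refl rewrite +-comm a 1 =
    trans (h-suc (≤-trans 2≤d (far-left y∈O eq))) (cong suc (sym (+-identityʳ (g a))))
  go {a = a} {m} vacant (inner {y = y} y∈O eq) (inner {z = z} z∈O eq′) =
    g-balanced 2≤d d≤a a≤1+d d≤m m≤1+d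
    where
    d≤a : d ≤ a
    d≤a = far-left y∈O eq
    d≤m : d ≤ m
    d≤m = far-right z∈O eq′
    1≤x : 1 ≤ toℕ x
    1≤x = ≤-trans (<⇒≤ 2≤d) (≤-trans d≤a (≤-trans (m≤n+m a (toℕ y)) (≤-reflexive eq)))
    a≤1+d : a ≤ suc d
    a≤1+d with left-close vacant close 1≤x (≤-trans 2≤d d≤a)
    ... | inj₁ (_ , _ , le) = le
    ... | inj₂ m<d          = contradiction d≤m (<⇒≱ m<d)
    x+1<n : suc (toℕ x) < n
    x+1<n = ≤-trans (2+≤ (toℕ x) (≤-trans 2≤d d≤m)) (subst (_≤ n) eq′ (<⇒≤ (toℕ<n z)))
    m≤1+d : m ≤ suc d
    m≤1+d with right-close vacant close x+1<n (≤-trans 2≤d d≤m)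
    ... | inj₁ a<d          = contradiction d≤a (<⇒≱ a<d)
    ... | inj₂ (_ , _ , le) = le

Φ-step : ∀ {O : Subset n} {x d} → Polite O x d → 2 ≤ d → Φ O ≡ suc (Φ (O ∪ ⁅ x ⁆))
Φ-step {O = O} {x} P 2≤d = trans before (trans
  (cong (_+ rest) (weight-step P 2≤d vacant left right)) (cong suc (sym after)))
  where open Gap (gapAround wall 1 O x (Polite.empty P))

-- As Close O 1, except that place 0 may also be next to a seat just before O.
CloseAfterSeat : Subset n → Set
CloseAfterSeat O = ∀ p → p ∉ O → toℕ p ≡ 0 ⊎ (∃[ y ] (y ∈ O × ∣ toℕ p - toℕ y ∣ ≤ 1))

-- A place that relied on the dropped first place is the new place 0, which the first alternative
-- covers.
close-after-seat : ∀ {b} {O : Subset n} → CloseAfterSeat (b ∷ O) → CloseAfterSeat O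
close-after-seat close p p∉O with close (suc p) (λ { (there p∈O) → p∉O p∈O })
... | inj₁ ()
... | inj₂ (zero  , _         , s≤s le) = inj₁ (n≤0⇒n≡0 le)
... | inj₂ (suc y , there y∈O , le)     = inj₂ (y , y∈O , le)

close-after-empty : ∀ {O : Subset n} → CloseAfterSeat (false ∷ O) → Close O 1
close-after-empty close p p∉O with close (suc p) (λ { (there p∈O) → p∉O p∈O })
... | inj₁ ()
... | inj₂ (zero  , ()        , _)
... | inj₂ (suc y , there y∈O , le) = y , y∈O , le

¬close-two-empty : ∀ {O : Subset n} → ¬ Close (false ∷ false ∷ O) 1
¬close-two-empty close with close zero (λ ())
... | zero        , ()       , _
... | suc zero    , there () , _
... | suc (suc _) , _        , s≤s ()

-- After a seat, the next seat comes after at most two empty places, or the wall after at most one.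
-- Only the values of `g` at 1, 2, 3 and of `h` at 0, 1 occur, and all of them are 0.
Φ-after-seat : ∀ (O : Subset n) → CloseAfterSeat O → Φ-from seat 1 O ≡ 0
Φ-after-seat []                        close = refl
Φ-after-seat (true ∷ O)                close = Φ-after-seat O (close-after-seat close)
Φ-after-seat (false ∷ [])              close = refl
Φ-after-seat (false ∷ true ∷ O)        close =
  Φ-after-seat O (close-after-seat (close-after-seat close))
Φ-after-seat (false ∷ false ∷ true ∷ O) close =
  Φ-after-seat O (close-after-seat (close-after-seat (close-after-seat close)))
Φ-after-seat (false ∷ false ∷ [])      close with close-after-empty close zero (λ ())
... | zero , () , _
Φ-after-seat (false ∷ false ∷ false ∷ O) close =
  contradiction (close-after-empty close) ¬close-two-empty

-- The run at the left wall has at most one empty place, since place 0 can only have its neighbour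
-- at place 1.
Φ-close : ∀ (O : Subset n) → Close O 1 → Φ O ≡ 0
Φ-close []                  close = refl
Φ-close (true ∷ O)          close = Φ-after-seat O (close-after-seat λ p p∉ → inj₂ (close p p∉))
Φ-close (false ∷ [])        close = refl
Φ-close (false ∷ true ∷ O)  close =
  Φ-after-seat O (close-after-seat (close-after-seat λ p p∉ → inj₂ (close p p∉)))
Φ-close (false ∷ false ∷ O) close = contradiction close ¬close-two-empty

-- Counting arrivals

far : List ℕ → ℕ
far ds = length (filter (2 ≤?_) ds)

∪-mono : ∀ {O : Subset n} x {y} → y ∈ O → y ∈ O ∪ ⁅ x ⁆
∪-mono x = p⊆p∪q ⁅ x ⁆

arrivals-positive : ∀ {A : Subset n → Fin n → Set} {O O′ ds} → Arrivals A O O′ ds → All (1 ≤_) ds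
arrivals-positive done              = []
arrivals-positive (arrive P _ rest) =
  distance-positive (Polite.empty P) (Polite.distance P) ∷ arrivals-positive rest

-- An arbitrary restriction `A` lets one count serve both processes. The closeness of the final
-- state comes from the stopping rule in one and is vacuous in the other, where the row is full.
far-arrivals : ∀ {A : Subset n → Fin n → Set} {O O′ ds} →
               Arrivals A O O′ ds → Close O′ 1 → far ds ≡ Φ O
far-arrivals {O = O} done close = sym (Φ-close O close)
far-arrivals {O = O} (arrive {x = x} {d = d} {ds = ds} P _ rest) close with 2 ≤? d
... | yes 2≤d = trans (cong length (filter-accept (2 ≤?_) 2≤d))
  (trans (cong suc (far-arrivals rest close)) (sym (Φ-step P 2≤d)))
-- If even the politest choice is at distance 1, every empty place has a seated neighbour. This
-- persists after the arrival, so `Φ` is 0 both before and after.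
... | no 2≰d = trans (cong length (filter-reject (2 ≤?_) 2≰d)) (trans (far-arrivals rest close)
  (trans (Φ-close (O ∪ ⁅ x ⁆) (close-⊆ (∪-mono x) close₁)) (sym (Φ-close O close₁))))
  where
  close₁ : Close O 1
  close₁ p p∉O with polite-close P p p∉O
  ... | y , y∈O , le = y , y∈O , ≤-trans le (≤-pred (≰⇒> 2≰d))

∣∪⁅x⁆∣ : ∀ {O : Subset n} {x} → x ∉ O → ∣ O ∪ ⁅ x ⁆ ∣ ≡ suc ∣ O ∣
∣∪⁅x⁆∣ {O = true  ∷ O} {zero}  x∉O = contradiction here x∉O
∣∪⁅x⁆∣ {O = false ∷ O} {zero}  x∉O = cong (suc ∘ ∣_∣) (∪-identityʳ O)
∣∪⁅x⁆∣ {O = true  ∷ O} {suc x} x∉O = cong suc (∣∪⁅x⁆∣ (x∉O ∘ there))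
∣∪⁅x⁆∣ {O = false ∷ O} {suc x} x∉O = ∣∪⁅x⁆∣ (x∉O ∘ there)

length-arrivals : ∀ {A : Subset n → Fin n → Set} {O O′ ds} →
                  Arrivals A O O′ ds → length ds + ∣ O ∣ ≡ ∣ O′ ∣
length-arrivals done = refl
length-arrivals {O = O} (arrive {ds = ds} P _ rest) = trans (sym (+-suc (length ds) ∣ O ∣))
  (trans (cong (length ds +_) (sym (∣∪⁅x⁆∣ (Polite.empty P)))) (length-arrivals rest))

length≡near+far : ∀ {ds} → All (1 ≤_) ds → length ds ≡ length (filter (_≟ 1) ds) + far ds
length≡near+far [] = refl
length≡near+far {1 ∷ ds} (_ ∷ ps) = cong suc (length≡near+far ps)
length≡near+far {suc (suc d) ∷ ds} (_ ∷ ps) =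
  trans (cong suc (length≡near+far ps)) (sym (+-suc (length (filter (_≟ 1) ds)) (far ds)))

-- Distance 1 would be attained by a neighbouring seat, which the restriction forbids.
spaced-far : ∀ {O O′ : Subset n} {ds} → Arrivals NotNeighbouring O O′ ds → All (2 ≤_) ds
spaced-far done = []
spaced-far (arrive P spaced rest) with Distance.attained (Polite.distance P)
... | y , y∈O , eq = ≤∧≢⇒< (distance-positive (Polite.empty P) (Polite.distance P))
  (λ 1≡d → spaced y y∈O (trans eq (sym 1≡d))) ∷ spaced-far rest

-- Existence of the seatings

polite-exists : ∀ {O : Subset n} {x y} → y ∈ O → x ∉ O → ∃[ z ] ∃[ d ] Polite O z d
polite-exists {n} {O} {x₀} y∈O x₀∉O = farthest , δ farthest , record
  { empty    = argmax-all δ x₀∉O (all-filter (¬? ∘ (_∈? O)) (allFin n))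
  ; distance = proj₂ (distance-exists y∈O farthest)
  ; maximal  = λ z e z∉O D → ≤-trans (distance≤δ z D)
      (All.lookup (f[xs]≤f[argmax] x₀ empties) (∈-filter⁺ (¬? ∘ (_∈? O)) (∈-allFin z) z∉O))
  }
  where
  δ : Fin n → ℕ
  δ z = proj₁ (distance-exists y∈O z)
  empties : List (Fin n)
  empties = filter (¬? ∘ (_∈? O)) (allFin n)
  farthest : Fin n
  farthest = argmax δ x₀ empties
  distance≤δ : ∀ z {e} → Distance O z e → e ≤ δ z
  distance≤δ z D with Distance.attained (proj₂ (distance-exists y∈O z))
  ... | w , w∈O , eq = subst (_ ≤_) eq (Distance.minimal D w w∈O)

module _ {n} {A : Subset n → Fin n → Set} {Stopped : Subset n → Set}
         (continue : ∀ O {y} → y ∈ O → Stopped O ⊎ (∃[ x ] ∃[ d ] (Polite O x d × A O x))) where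

  -- Each arrival enlarges the set of seats, which has at most n elements. The invariant n ≤ fuel +
  -- ∣ O ∣ therefore excludes an arrival once the fuel is 0.
  arrivals-exist : ∀ O {y} → y ∈ O → ∃[ O′ ] ∃[ ds ] (Arrivals A O O′ ds × Stopped O′)
  arrivals-exist O y∈O = seat-all n O y∈O (m≤m+n n ∣ O ∣)
    where
    seat-all : ∀ fuel O {y} → y ∈ O → n ≤ fuel + ∣ O ∣ →
               ∃[ O′ ] ∃[ ds ] (Arrivals A O O′ ds × Stopped O′)
    seat-all fuel O y∈O enough with continue O y∈O
    seat-all fuel O y∈O enough | inj₁ stopped = O , [] , done , stopped
    seat-all zero O y∈O enough | inj₂ (x , d , P , _) =
      contradiction (≤-trans (≤-reflexive (sym (∣∪⁅x⁆∣ (Polite.empty P)))) (∣p∣≤n (O ∪ ⁅ x ⁆)))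
        (<⇒≱ (s≤s enough))
    seat-all (suc fuel) O y∈O enough | inj₂ (x , d , P , allowed)
      with seat-all fuel (O ∪ ⁅ x ⁆) (∪-mono x y∈O) (≤-trans enough (≤-reflexive
             (trans (sym (+-suc fuel ∣ O ∣)) (cong (fuel +_) (sym (∣∪⁅x⁆∣ (Polite.empty P)))))))
    ... | O′ , ds , rest , stopped = O′ , d ∷ ds , arrive P allowed rest , stopped

continue-full : ∀ (O : Subset n) {y} → y ∈ O →
                O ≡ full ⊎ (∃[ x ] ∃[ d ] (Polite O x d × Unrestricted O x))
continue-full O y∈O with any? (λ x → ¬? (x ∈? O))
... | yes (x , x∉O) = let z , d , P = polite-exists y∈O x∉O in inj₂ (z , d , P , tt)
... | no no-empty   = inj₁ (⊆-antisym ⊆⊤ λ {x} _ →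
  decidable-stable (x ∈? O) (λ x∉O → no-empty (x , x∉O)))

polite-near : ∀ {O : Subset n} {x d y} → y ∈ O → Polite O x d → ¬ 2 ≤ d →
              ∀ p → p ∉ O → Distance O p 1
polite-near {O = O} y∈O P 2≰d p p∉O = subst (Distance O p) e≡1 D
  where
  D = proj₂ (distance-exists y∈O p)
  e≡1 = ≤-antisym (≤-trans (Polite.maximal P p _ p∉O D) (≤-pred (≰⇒> 2≰d)))
                  (distance-positive p∉O D)

polite-spaced : ∀ {O : Subset n} {x d} → Polite O x d → 2 ≤ d → NotNeighbouring O x
polite-spaced {d = d} P 2≤d y y∈O eq =
  <⇒≱ 2≤d (subst (d ≤_) eq (Distance.minimal (Polite.distance P) y y∈O))

-- A single polite candidate decides: at distance 2 or more it has no seated neighbour; otherwise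
-- maximality puts every empty place at distance 1.
continue-spaced : ∀ (O : Subset n) {y} → y ∈ O → (∀ x → x ∉ O → Distance O x 1) ⊎
                  (∃[ x ] ∃[ d ] (Polite O x d × NotNeighbouring O x))
continue-spaced O y∈O with any? (λ x → ¬? (x ∈? O))
... | no no-empty   = inj₁ λ x x∉O → contradiction (x , x∉O) no-empty
... | yes (x , x∉O) = choose (polite-exists y∈O x∉O)
  where
  choose : (∃[ x ] ∃[ d ] Polite O x d) → (∀ x → x ∉ O → Distance O x 1) ⊎
           (∃[ x ] ∃[ d ] (Polite O x d × NotNeighbouring O x))
  choose (x , d , P) with 2 ≤? d
  ... | yes 2≤d = inj₂ (x , d , P , polite-spaced P 2≤d)
  ... | no  2≰d = inj₁ (polite-near y∈O P 2≰d)

fullSeating : ∀ n → FullSeating (suc n)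
fullSeating n with arrivals-exist continue-full ⁅ zero ⁆ (x∈⁅x⁆ {suc n} zero)
... | _ , ds , arrivals , refl = record
  { first = zero ; first-leftmost = refl ; distances = ds ; arrivals = arrivals }

spacedSeating : ∀ n → SpacedSeating (suc n)
spacedSeating n with arrivals-exist continue-spaced ⁅ zero ⁆ (x∈⁅x⁆ {suc n} zero)
... | O , ds , arrivals , stopped = record
  { first = zero ; first-end = inj₁ refl ; final = O ; distances = ds
  ; arrivals = arrivals ; stopped = stopped }

-- The values of the two counts

spaced-persons : ∀ {n} (s : SpacedSeating (suc n)) → SpacedSeating.persons s ≡ suc (h n)
spaced-persons {n} s = cong suc (begin
  length distances   ≡⟨ cong length (filter-all (2 ≤?_) (spaced-far arrivals)) ⟨
  far distances      ≡⟨ far-arrivals arrivals close ⟩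
  Φ ⁅ first ⁆        ≡⟨ Φ-end first first-end ⟩
  h n                ∎)
  where
  open ≡-Reasoning
  open SpacedSeating s
  close : Close final 1
  close p p∉O with Distance.attained (stopped p p∉O)
  ... | y , y∈O , eq = y , y∈O , ≤-reflexive eq

-- Filling n + 1 places takes n persons after the first; their distances are positive, and those at
-- distance 2 or more number `h n`.
full-near : ∀ {n} (s : FullSeating (suc n)) → FullSeating.personsAtDistance s 1 + h n ≡ n
full-near {n} s = begin
  personsAtDistance 1 + h n              ≡⟨ cong (personsAtDistance 1 +_) (sym far≡) ⟩
  personsAtDistance 1 + far distances    ≡⟨ length≡near+far (arrivals-positive arrivals) ⟨
  length distances                       ≡⟨ suc-injective length≡ ⟩
  n                                      ∎
  where
  open ≡-Reasoning
  open FullSeating s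
  far≡ : far distances ≡ h n
  far≡ = trans (far-arrivals arrivals (λ p p∉ → contradiction ∈⊤ p∉))
    (Φ-end first (inj₁ first-leftmost))
  length≡ : suc (length distances) ≡ suc n
  length≡ = begin
    suc (length distances)               ≡⟨ +-comm 1 (length distances) ⟩
    length distances + 1                 ≡⟨ cong (length distances +_) (∣⁅x⁆∣≡1 first) ⟨
    length distances + ∣ ⁅ first ⁆ ∣     ≡⟨ length-arrivals arrivals ⟩
    ∣ full {suc n} ∣                     ≡⟨ ∣⊤∣≡n (suc n) ⟩
    suc n                                ∎

mainTheorem4 : (n : ℕ) → .{{_ : NonZero n}} →
    ∃[ a ] ∃[ b ] (IsA166079 n a × IsB n 1 b × a ≡ n ∸ b)
mainTheorem4 (suc n) = suc (h n) , b ,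
  ((spacedSeating n , spaced-persons (spacedSeating n)) , spaced-persons) ,
  -- The value b is read off one seating; any other gives the same sum with `h n`, so cancellation
  -- makes the counts equal.
  ((fullSeating n , refl) , λ s → +-cancelʳ-≡ (h n) _ _ (trans (full-near s) (sym b+h≡n))) ,
  (begin
    suc (h n)              ≡⟨ m+n∸m≡n b (suc (h n)) ⟨
    (b + suc (h n)) ∸ b    ≡⟨ cong (_∸ b) (trans (+-suc b (h n)) (cong suc b+h≡n)) ⟩
    suc n ∸ b              ∎)
  where
  open ≡-Reasoning
  b : ℕ
  b = FullSeating.personsAtDistance (fullSeating n) 1
  b+h≡n : b + h n ≡ n
  b+h≡n = full-near (fullSeating n)
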